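{- Let $a$ be a positive even integer and let $b$ be a prime with $b \equiv 3 \pmod 8$. Then the equation $(a^n-1)(b^n-1)=x^2$ has no solution in positive integers $n, x$. -}

module Defs where

{-# OPTIONS --safe #-}

-- If n is odd, then bⁿ ∸ 1 ≡ 2 (mod 4) and aⁿ ∸ 1 is odd, so the product is
-- no square.  If n = 2m, put A = aᵐ, B = bᵐ and C = A B + x; the equation
-- becomes A² + B² + C² = 1 + 2 A B C, the identity satisfied by cosh α,
-- cosh β, cosh (α + β).  Replacing the largest entry by its Vieta conjugate
-- descends to B = 1, A = C, and the half-angle relations B + 1 = 2 X²,
-- A + C = 2 X Y (X = cosh (β/2), Y = cosh (α + β/2)) propagate back up with
-- integral X and Y.  Hence (2 X)² = 2 + 2 B, so 2 is a square modulo b, which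
-- is impossible when b ≡ 3 (mod 8).
module Submission where

open import Defs
open import Data.Nat using (ℕ; _+_; _*_; _∸_; _^_; _<_; _%_)
open import Data.Nat.Divisibility using (_∣_)
open import Data.Nat.Primality using (Prime)
open import Relation.Binary.PropositionalEquality using (_≡_)
open import Relation.Nullary using (¬_)
open import Data.Product using (∃₂; _×_)

open import Data.Empty using (⊥; ⊥-elim)
open import Data.Nat using (zero; suc; _≤_; _/_; z≤n; s≤s; z<s; NonZero; >-nonZero)
open import Data.Nat.Divisibility using (divides; ∣m⇒∣m*n; ∣n⇒∣m*n; ∣m∣n⇒∣m+n; ∣m+n∣m⇒∣n; ∣-refl; ∣⇒≤)
open import Data.Nat.DivMod using (m≡m%n+[m/n]*n; [m+kn]%n≡m%n; m*n%n≡0; m%n<n; m<n⇒m%n≡m; %-distribˡ-*; %-distribˡ-+)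
open import Data.Nat.Induction using (Acc; acc; <-wellFounded)
open import Data.Nat.Primality using (prime[2]; euclidsLemma)
open import Data.Nat.Properties
open import Data.Nat.Tactic.RingSolver using (solve-∀)
open import Data.Product using (∃; _,_; proj₁; proj₂)
open import Data.Sum using (_⊎_; inj₁; inj₂; [_,_]′; reduce)
open import Relation.Binary.PropositionalEquality using (refl; sym; trans; cong; cong₂; subst; subst₂; module ≡-Reasoning)

-- Parity, squares modulo 8, and 2 as a quadratic non-residue.

even⊎odd : ∀ n → ∃ λ k → n ≡ k * 2 ⊎ n ≡ 1 + k * 2
even⊎odd zero = 0 , inj₁ refl
even⊎odd (suc n) with even⊎odd n
... | k , inj₁ p = k , inj₂ (cong suc p)
... | k , inj₂ p = suc k , inj₁ (cong suc p)

odd²≡1mod8 : ∀ i → ∃ λ t → (1 + i * 2) * (1 + i * 2) ≡ 1 + t * 8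
odd²≡1mod8 i with even⊎odd i
... | j , inj₁ refl = j + 2 * (j * j) , eq j
  where
  eq : ∀ j → (1 + j * 2 * 2) * (1 + j * 2 * 2) ≡ 1 + (j + 2 * (j * j)) * 8
  eq = solve-∀
... | j , inj₂ refl = 1 + 3 * j + 2 * (j * j) , eq j
  where
  eq : ∀ j → (1 + (1 + j * 2) * 2) * (1 + (1 + j * 2) * 2) ≡ 1 + (1 + 3 * j + 2 * (j * j)) * 8
  eq = solve-∀

-- Both classes are carried along because the descent in `2-nonresidue` alternates between them; a
-- claim about residue 3 alone would not be inductive.
±3mod8 : ℕ → Set
±3mod8 n = n % 8 ≡ 3 ⊎ n % 8 ≡ 5

2+3r≡1mod8 : ∀ r → r < 8 → (2 + (r * 3) % 8) % 8 ≡ 1 → r ≡ 5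
2+3r≡1mod8 0 _ ()
2+3r≡1mod8 1 _ ()
2+3r≡1mod8 2 _ ()
2+3r≡1mod8 3 _ ()
2+3r≡1mod8 4 _ ()
2+3r≡1mod8 5 _ _ = refl
2+3r≡1mod8 6 _ ()
2+3r≡1mod8 7 _ ()
2+3r≡1mod8 (suc (suc (suc (suc (suc (suc (suc (suc r)))))))) r<8 _ = ⊥-elim (m+n≮m 8 r r<8)

2+5r≡1mod8 : ∀ r → r < 8 → (2 + (r * 5) % 8) % 8 ≡ 1 → r ≡ 3
2+5r≡1mod8 0 _ ()
2+5r≡1mod8 1 _ ()
2+5r≡1mod8 2 _ ()
2+5r≡1mod8 3 _ _ = refl
2+5r≡1mod8 4 _ ()
2+5r≡1mod8 5 _ ()
2+5r≡1mod8 6 _ ()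
2+5r≡1mod8 7 _ ()
2+5r≡1mod8 (suc (suc (suc (suc (suc (suc (suc (suc r)))))))) r<8 _ = ⊥-elim (m+n≮m 8 r r<8)

-- An odd square is 1 modulo 8, so k N ≡ -1 (mod 8). Solving this for `k` sends residue 3 of `N` to
-- 5 and residue 5 to 3.
cofactor-±3mod8 : ∀ N i k → ±3mod8 N → (1 + i * 2) * (1 + i * 2) ≡ 2 + k * N → ±3mod8 k
cofactor-±3mod8 N i k N≡±3 eq = [ (λ p → inj₂ (2+3r≡1mod8 (k % 8) (m%n<n k 8) (residue p)))
                                , (λ p → inj₁ (2+5r≡1mod8 (k % 8) (m%n<n k 8) (residue p))) ]′ N≡±3
  where
  open ≡-Reasoning
  residue : ∀ {c} → N % 8 ≡ c → (2 + (k % 8 * c) % 8) % 8 ≡ 1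
  residue refl = begin
    (2 + (k % 8 * (N % 8)) % 8) % 8      ≡⟨ cong (λ z → (2 + z) % 8) (%-distribˡ-* k N 8) ⟨
    (2 + (k * N) % 8) % 8                ≡⟨ %-distribˡ-+ 2 (k * N) 8 ⟨
    (2 + k * N) % 8                      ≡⟨ cong (_% 8) eq ⟨
    ((1 + i * 2) * (1 + i * 2)) % 8      ≡⟨ cong (_% 8) (proj₂ (odd²≡1mod8 i)) ⟩
    (1 + proj₁ (odd²≡1mod8 i) * 8) % 8   ≡⟨ [m+kn]%n≡m%n 1 (proj₁ (odd²≡1mod8 i)) 8 ⟩
    1                                    ∎

±3mod8⇒2< : ∀ N → ±3mod8 N → 2 < N
±3mod8⇒2< N p = subst (2 <_) (sym (m≡m%n+[m/n]*n N 8)) (≤-trans (bound p) (m≤m+n (N % 8) _))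
  where
  bound : ±3mod8 N → 2 < N % 8
  bound (inj₁ q) rewrite q = s≤s (s≤s (s≤s z≤n))
  bound (inj₂ q) rewrite q = s≤s (s≤s (s≤s z≤n))

±3mod8⇒odd : ∀ N → ±3mod8 N → ∃ λ q → N ≡ 1 + q * 2
±3mod8⇒odd N (inj₁ p) = 1 + N / 8 * 4 , trans (m≡m%n+[m/n]*n N 8) (trans (cong (_+ N / 8 * 8) p) (eq (N / 8)))
  where
  eq : ∀ q → 3 + q * 8 ≡ 1 + (1 + q * 4) * 2
  eq = solve-∀
±3mod8⇒odd N (inj₂ p) = 2 + N / 8 * 4 , trans (m≡m%n+[m/n]*n N 8) (trans (cong (_+ N / 8 * 8) p) (eq (N / 8)))
  where
  eq : ∀ q → 5 + q * 8 ≡ 1 + (2 + q * 4) * 2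
  eq = solve-∀

-- If N divides x² − 2, reducing x modulo N and possibly passing to N − x
-- gives an odd root below N.
small-odd-root : ∀ N → ±3mod8 N → ∀ x k → x * x ≡ 2 + k * N →
                 ∃₂ λ i l → 1 + i * 2 < N × (1 + i * 2) * (1 + i * 2) ≡ 2 + l * N
small-odd-root N N≡±3 x k eq = choose (even⊎odd r)
  where
  open ≡-Reasoning
  2<N : 2 < N
  2<N = ±3mod8⇒2< N N≡±3
  instance
    N≢0 : NonZero N
    N≢0 = >-nonZero (≤-trans z<s 2<N)
  q r s : ℕ
  q = proj₁ (±3mod8⇒odd N N≡±3)
  r = x % N
  s = N ∸ r
  r<N : r < N
  r<N = m%n<n x N
  s+r≡N : s + r ≡ N
  s+r≡N = m∸n+n≡m (<⇒≤ r<N)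
  r²%N≡2 : (r * r) % N ≡ 2
  r²%N≡2 = begin
    (r * r) % N      ≡⟨ %-distribˡ-* x x N ⟨
    (x * x) % N      ≡⟨ cong (_% N) eq ⟩
    (2 + k * N) % N  ≡⟨ [m+kn]%n≡m%n 2 k N ⟩
    2 % N            ≡⟨ m<n⇒m%n≡m 2<N ⟩
    2                ∎
  expand : ∀ y → (y * y) % N ≡ 2 → y * y ≡ 2 + (y * y / N) * N
  expand y p = trans (m≡m%n+[m/n]*n (y * y) N) (cong (_+ (y * y / N) * N) p)
  reflect : ∀ s r → s * s + r * (s + r) ≡ r * r + s * (s + r)
  reflect = solve-∀
  s²%N≡2 : (s * s) % N ≡ 2
  s²%N≡2 = begin
    (s * s) % N              ≡⟨ [m+kn]%n≡m%n (s * s) r N ⟨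
    (s * s + r * N) % N      ≡⟨ cong (_% N) (subst (λ z → s * s + r * z ≡ r * r + s * z) s+r≡N (reflect s r)) ⟩
    (r * r + s * N) % N      ≡⟨ [m+kn]%n≡m%n (r * r) s N ⟩
    (r * r) % N              ≡⟨ r²%N≡2 ⟩
    2                        ∎
  Root : Set
  Root = ∃₂ λ i l → 1 + i * 2 < N × (1 + i * 2) * (1 + i * 2) ≡ 2 + l * N
  from-odd : ∀ y → y < N → (y * y) % N ≡ 2 → ∀ i → y ≡ 1 + i * 2 → Root
  from-odd y y<N p i refl = i , y * y / N , y<N , expand y p
  choose : (∃ λ i → r ≡ i * 2 ⊎ r ≡ 1 + i * 2) → Root
  choose (i , inj₂ p) = from-odd r r<N r²%N≡2 i p
  choose (i , inj₁ r≡2i) with even⊎odd s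
  -- `s` and `r` sum to the odd number `N`, so they cannot both be even.
  ... | j , inj₁ s≡2j = ⊥-elim (even≢odd (j + i) q (begin
    2 * (j + i)      ≡⟨ *-comm 2 (j + i) ⟩
    (j + i) * 2      ≡⟨ *-distribʳ-+ 2 j i ⟩
    j * 2 + i * 2    ≡⟨ cong₂ _+_ s≡2j r≡2i ⟨
    s + r            ≡⟨ s+r≡N ⟩
    N                ≡⟨ proj₂ (±3mod8⇒odd N N≡±3) ⟩
    1 + q * 2        ≡⟨ cong suc (*-comm q 2) ⟩
    1 + 2 * q        ∎))
  ... | j , inj₂ s≡1+2j = from-odd s s<N s²%N≡2 j s≡1+2j
    where
    -- Only `r ≡ 0` could spoil `s < N`, but then `r * r` would leave remainder 0 instead of 2.
    r≢0 : r ≡ 0 → ⊥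
    r≢0 r≡0 with trans (sym r²%N≡2) (trans (cong (λ z → (z * z) % N) r≡0) (m<n⇒m%n≡m (≤-trans z<s 2<N)))
    ... | ()
    s<N : s < N
    s<N = subst (s <_) s+r≡N (m<m+n s (n≢0⇒n>0 r≢0))

-- The cofactor of an odd root below N is again ≡ ±3 (mod 8) and smaller than N.
2-nonresidue : ∀ N → ±3mod8 N → ∀ x k → ¬ (x * x ≡ 2 + k * N)
2-nonresidue N = go N (<-wellFounded N)
  where
  go : ∀ N → Acc _<_ N → ±3mod8 N → ∀ x k → ¬ (x * x ≡ 2 + k * N)
  go N (acc rec) N≡±3 x k eq with small-odd-root N N≡±3 x k eq
  ... | i , l , y<N , y²≡2+lN =
    -- The same root works for `l`, with `N` now as the cofactor.
    go l (rec l<N) (cofactor-±3mod8 N i l N≡±3 y²≡2+lN) (1 + i * 2) N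
       (trans y²≡2+lN (cong (2 +_) (*-comm l N)))
    where
    l<N : l < N
    l<N = *-cancelʳ-< N l N (<-≤-trans (m<n+m (l * N) z<s)
            (≤-trans (≤-reflexive (sym y²≡2+lN)) (*-mono-≤ (<⇒≤ y<N) (<⇒≤ y<N))))

-- Cosh triples, Vieta jumping and half-angle relations.

CoshTriple : ℕ → ℕ → ℕ → Set
CoshTriple u v w = u * u + v * v + w * w ≡ 1 + 2 * (u * v) * w

swap₁₂ : ∀ u v w → CoshTriple u v w → CoshTriple v u w
swap₁₂ u v w t = trans (cong (_+ w * w) (+-comm (v * v) (u * u))) (trans t (cong (λ z → 1 + 2 * z * w) (*-comm u v)))

swap₂₃ : ∀ u v w → CoshTriple u v w → CoshTriple u w v
swap₂₃ u v w t = trans (lhs u v w) (trans t (rhs u v w))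
  where
  lhs : ∀ u v w → u * u + w * w + v * v ≡ u * u + v * v + w * w
  lhs = solve-∀
  rhs : ∀ u v w → 1 + 2 * (u * v) * w ≡ 1 + 2 * (u * w) * v
  rhs = solve-∀

-- Otherwise d = u v − w satisfies d² = (u² − 1)(v² − 1) and d ≤ (u − 1) v,
-- which forces 2 v² ≤ u + 1.
sorted⇒product<largest : ∀ u v w → 2 ≤ u → u ≤ v → v ≤ w → CoshTriple u v w → u * v < w
sorted⇒product<largest u@(suc p@(suc _)) v w (s≤s (s≤s z≤n)) u≤v v≤w t = ≰⇒> λ w≤uv → go (u * v ∸ w) (m+[n∸m]≡n w≤uv)
  where
  go : ∀ d → w + d ≡ u * v → ⊥
  go d w+d≡uv = <⇒≱ 2+p<2v² 2v²≤2+p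
    where
    d≤pv : d ≤ p * v
    d≤pv = +-cancelˡ-≤ v d (p * v) (≤-trans (+-monoˡ-≤ d v≤w) (≤-reflexive w+d≡uv))
    expand : ∀ w d → 1 + 2 * (w + d) * w + d * d ≡ w * w + (1 + (w + d) * (w + d))
    expand = solve-∀
    assemble : ∀ S w d → S + w * w + d * d ≡ w * w + (d * d + S)
    assemble = solve-∀
    d²-identity : d * d + (u * u + v * v) ≡ 1 + u * v * (u * v)
    d²-identity = +-cancelˡ-≡ (w * w) _ _ (trans (sym (assemble (u * u + v * v) w d))
      (trans (cong (_+ d * d) t)
        (subst (λ z → 1 + 2 * z * w + d * d ≡ w * w + (1 + z * z)) w+d≡uv (expand w d))))
    lower : ∀ p v → 1 + (1 + p) * v * ((1 + p) * v) ≡ p * v * (p * v) + v * v + 1 + p * (2 * (v * v))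
    lower = solve-∀
    upper : ∀ p v → p * v * (p * v) + ((1 + p) * (1 + p) + v * v) ≡ p * v * (p * v) + v * v + 1 + p * (2 + p)
    upper = solve-∀
    open ≤-Reasoning
    2v²≤2+p : 2 * (v * v) ≤ 2 + p
    -- Both sides of the estimate contain p² v² + v² + 1. What remains has the factor `p`, which is
    -- nonzero because u ≥ 2.
    2v²≤2+p = *-cancelˡ-≤ p (+-cancelˡ-≤ (p * v * (p * v) + v * v + 1) _ _ (begin
      p * v * (p * v) + v * v + 1 + p * (2 * (v * v))  ≡⟨ lower p v ⟨
      1 + u * v * (u * v)                               ≡⟨ d²-identity ⟨
      d * d + (u * u + v * v)                           ≤⟨ +-monoˡ-≤ _ (*-mono-≤ d≤pv d≤pv) ⟩
      p * v * (p * v) + (u * u + v * v)                 ≡⟨ upper p v ⟩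
      p * v * (p * v) + v * v + 1 + p * (2 + p)         ∎))
    2≤v : 2 ≤ v
    2≤v = ≤-trans (s≤s (s≤s z≤n)) u≤v
    2+p<2v² : 2 + p < 2 * (v * v)
    2+p<2v² = begin-strict
      1 + u          <⟨ s≤s (s≤s u≤v) ⟩
      2 + v          ≤⟨ +-monoˡ-≤ v 2≤v ⟩
      v + v          ≡⟨ cong (v +_) (+-identityʳ v) ⟨
      2 * v          ≤⟨ *-monoˡ-≤ v 2≤v ⟩
      v * v          ≤⟨ m≤m+n (v * v) _ ⟩
      2 * (v * v)    ∎

product<largest : ∀ u v w → 2 ≤ u → 2 ≤ v → u ≤ w → v ≤ w → CoshTriple u v w → u * v < w
product<largest u v w 2≤u 2≤v u≤w v≤w t with ≤-total u v
... | inj₁ u≤v = sorted⇒product<largest u v w 2≤u u≤v v≤w t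
... | inj₂ v≤u = subst (_< w) (*-comm v u) (sorted⇒product<largest v u w 2≤v v≤u u≤w (swap₁₂ u v w t))

-- `w` and `w′` are the roots of z² - 2 u v z + (u² + v² - 1). From u² + v² > 1 follows w² < 2 u v
-- w, so `w′` is positive; and w′ < w amounts to u v < w, which is `product<largest`.
vieta-jump : ∀ u v w → 2 ≤ u → 2 ≤ v → u ≤ w → v ≤ w → CoshTriple u v w →
             ∃ λ w′ → w + w′ ≡ 2 * (u * v) × 0 < w′ × w′ < w × CoshTriple u v w′
vieta-jump u v w 2≤u 2≤v u≤w v≤w t = w′ , sum , m<n⇒0<n∸m w<2uv , w′<w , triple
  where
  w<2uv : w < 2 * (u * v)
  w<2uv = *-cancelʳ-< w w (2 * (u * v)) (+-cancelˡ-< 1 _ _ (subst (1 + w * w <_) t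
    (+-monoˡ-< (w * w) (≤-trans (*-mono-≤ {1} {u} {2} {u} (≤-trans (s≤s z≤n) 2≤u) 2≤u) (m≤m+n (u * u) (v * v))))))
  w′ : ℕ
  w′ = 2 * (u * v) ∸ w
  sum : w + w′ ≡ 2 * (u * v)
  sum = m+[n∸m]≡n (<⇒≤ w<2uv)
  w′<w : w′ < w
  w′<w = +-cancelˡ-< w w′ w (subst₂ _<_ (sym sum) (cong (w +_) (+-identityʳ w))
    (*-monoʳ-< 2 (product<largest u v w 2≤u 2≤v u≤w v≤w t)))
  expand : ∀ w w′ → 1 + (w + w′) * w ≡ 1 + w′ * w + w * w
  expand = solve-∀
  collect : ∀ w w′ → 1 + w′ * w + w′ * w′ ≡ 1 + (w + w′) * w′
  collect = solve-∀
  vieta-product : u * u + v * v ≡ 1 + w′ * w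
  vieta-product = +-cancelʳ-≡ (w * w) _ _ (trans t (trans (cong (λ z → 1 + z * w) (sym sum)) (expand w w′)))
  triple : CoshTriple u v w′
  triple = trans (cong (_+ w′ * w′) vieta-product) (trans (collect w w′) (cong (λ z → 1 + z * w′) sum))

-- The second relation is recorded along with the first because a jump in `B` exchanges `X` and `Y`:
-- knowing `X` alone would not yield the half-angle of the new `B`.
HalfAngle : ℕ → ℕ → ℕ → Set
HalfAngle A B C = ∃₂ λ X Y → 1 + B ≡ 2 * (X * X) × A + C ≡ 2 * (X * Y)

halfAngle-sym : ∀ A B C → HalfAngle A B C → HalfAngle C B A
halfAngle-sym A B C (X , Y , p , q) = X , Y , p , trans (+-comm C A) q

-- For B = 1 the triple equation reads (A - C)² = 0, and the half-angle values are X = 1, Y = A. The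
-- helper `equal` treats A ≤ C; symmetry gives the other case.
halfAngle-base : ∀ A C → CoshTriple A 1 C → HalfAngle A 1 C
halfAngle-base A C t = 1 , A , refl , trans (cong (A +_) (sym A≡C)) (double A)
  where
  double : ∀ A → A + A ≡ 2 * (1 * A)
  double = solve-∀
  equal : ∀ A d → CoshTriple A 1 (A + d) → A ≡ A + d
  equal A d t = sym (trans (cong (A +_) d≡0) (+-identityʳ A))
    where
    lhs : ∀ A d → A * A + 1 * 1 + (A + d) * (A + d) ≡ 1 + 2 * (A * 1) * (A + d) + d * d
    lhs = solve-∀
    d²≡0 : d * d ≡ 0
    d²≡0 = +-cancelˡ-≡ _ (d * d) 0 (trans (sym (lhs A d)) (trans t (sym (+-identityʳ _))))
    d≡0 : d ≡ 0
    d≡0 = reduce (m*n≡0⇒m≡0∨n≡0 d d²≡0)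
  A≡C : A ≡ C
  A≡C with ≤-total A C
  ... | inj₁ A≤C = trans (equal A (C ∸ A) (subst (CoshTriple A 1) (sym (m+[n∸m]≡n A≤C)) t)) (m+[n∸m]≡n A≤C)
  ... | inj₂ C≤A = sym (trans (equal C (A ∸ C) (subst (CoshTriple C 1) (sym (m+[n∸m]≡n C≤A))
                     (swap₂₃ C A 1 (swap₁₂ A C 1 (swap₂₃ A 1 C t))))) (m+[n∸m]≡n C≤A))

-- The half-angle of 2 A C − B is Y, since 2 Y² = 1 + cosh (2 α + β).
halfAngle-jump₂ : ∀ A B B′ C → B + B′ ≡ 2 * (A * C) → CoshTriple A B′ C → HalfAngle A B′ C → HalfAngle A B C
halfAngle-jump₂ A B B′ C sum t (X , Y , 1+B′≡2X² , A+C≡2XY) = Y , X , 1+B≡2Y² , trans A+C≡2XY (cong (2 *_) (*-comm X Y))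
  where
  open ≡-Reasoning
  regroup : ∀ X Y B′ → 2 * (X * X) * (2 * (Y * Y) + B′) ≡ 2 * (X * Y) * (2 * (X * Y)) + 2 * (X * X) * B′
  regroup = solve-∀
  square : ∀ A B′ C → (A + C) * (A + C) + (1 + B′) * B′ ≡ A * A + B′ * B′ + C * C + (2 * (A * C) + B′)
  square = solve-∀
  factor : ∀ A B′ C → 1 + 2 * (A * B′) * C + (2 * (A * C) + B′) ≡ (1 + B′) * (1 + 2 * (A * C))
  factor = solve-∀
  -- Multiplication by 1 + B′ = 2 X² turns 2 Y² into (2 X Y)² = (A + C)², which the triple equation
  -- for `B′` evaluates.
  2Y²+B′ : 2 * (Y * Y) + B′ ≡ 1 + 2 * (A * C)
  2Y²+B′ = *-cancelˡ-≡ _ _ (1 + B′) (begin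
    (1 + B′) * (2 * (Y * Y) + B′)                     ≡⟨ cong (_* (2 * (Y * Y) + B′)) 1+B′≡2X² ⟩
    2 * (X * X) * (2 * (Y * Y) + B′)                  ≡⟨ regroup X Y B′ ⟩
    2 * (X * Y) * (2 * (X * Y)) + 2 * (X * X) * B′    ≡⟨ cong₂ (λ y z → y * y + z * B′) A+C≡2XY 1+B′≡2X² ⟨
    (A + C) * (A + C) + (1 + B′) * B′                 ≡⟨ square A B′ C ⟩
    A * A + B′ * B′ + C * C + (2 * (A * C) + B′)      ≡⟨ cong (_+ (2 * (A * C) + B′)) t ⟩
    1 + 2 * (A * B′) * C + (2 * (A * C) + B′)         ≡⟨ factor A B′ C ⟩
    (1 + B′) * (1 + 2 * (A * C))                      ∎)
  1+B≡2Y² : 1 + B ≡ 2 * (Y * Y)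
  1+B≡2Y² = +-cancelʳ-≡ B′ _ _ (trans (cong suc sum) (sym 2Y²+B′))

-- Y is replaced by 2 A X − Y, since cosh (α + β/2) + cosh (α − β/2) = 2 cosh α cosh (β/2).
halfAngle-jump₃ : ∀ A B C C′ → C + C′ ≡ 2 * (A * B) → HalfAngle A B C′ → HalfAngle A B C
halfAngle-jump₃ A B C C′ sum (zero , Y , () , _)
halfAngle-jump₃ A B C C′ sum (X@(suc _) , Y , 1+B≡2X² , A+C′≡2XY) = X , 2 * (A * X) ∸ Y , 1+B≡2X² , A+C≡2X[2AX-Y]
  where
  split : ∀ A B → 2 * A * (1 + B) ≡ 2 * A + 2 * (A * B)
  split = solve-∀
  regroup : ∀ A C C′ → 2 * A + (C + C′) ≡ A + C + (A + C′)
  regroup = solve-∀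
  factor : ∀ A X → 2 * A * (2 * (X * X)) ≡ 2 * (X * (2 * (A * X)))
  factor = solve-∀
  total : A + C + (A + C′) ≡ 2 * (X * (2 * (A * X)))
  total = begin
    A + C + (A + C′)           ≡⟨ regroup A C C′ ⟨
    2 * A + (C + C′)           ≡⟨ cong (2 * A +_) sum ⟩
    2 * A + 2 * (A * B)        ≡⟨ split A B ⟨
    2 * A * (1 + B)            ≡⟨ cong (2 * A *_) 1+B≡2X² ⟩
    2 * A * (2 * (X * X))      ≡⟨ factor A X ⟩
    2 * (X * (2 * (A * X)))    ∎
    where open ≡-Reasoning
  -- This makes the truncated subtraction in the new `Y` exact: 2 X Y = A + C′ is a summand of
  -- `total`, and the positive factor 2 X cancels.
  Y≤2AX : Y ≤ 2 * (A * X)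
  Y≤2AX = *-cancelˡ-≤ X (*-cancelˡ-≤ 2 (subst₂ _≤_ A+C′≡2XY total (m≤n+m (A + C′) (A + C))))
  distrib : ∀ X Z Y → 2 * (X * (Z + Y)) ≡ 2 * (X * Z) + 2 * (X * Y)
  distrib = solve-∀
  A+C≡2X[2AX-Y] : A + C ≡ 2 * (X * (2 * (A * X) ∸ Y))
  A+C≡2X[2AX-Y] = +-cancelʳ-≡ (A + C′) _ _ (begin
    A + C + (A + C′)                                      ≡⟨ total ⟩
    2 * (X * (2 * (A * X)))                               ≡⟨ cong (λ z → 2 * (X * z)) (m∸n+n≡m Y≤2AX) ⟨
    2 * (X * (2 * (A * X) ∸ Y + Y))                       ≡⟨ distrib X (2 * (A * X) ∸ Y) Y ⟩
    2 * (X * (2 * (A * X) ∸ Y)) + 2 * (X * Y)             ≡⟨ cong (2 * (X * (2 * (A * X) ∸ Y)) +_) A+C′≡2XY ⟨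
    2 * (X * (2 * (A * X) ∸ Y)) + (A + C′)                ∎)
    where open ≡-Reasoning

-- Descent to the half-angle relations.

conjugate-even : ∀ {w w′} n → 2 ∣ w → w + w′ ≡ 2 * n → 2 ∣ w′
conjugate-even n 2∣w p = ∣m+n∣m⇒∣n (subst (2 ∣_) (sym p) (∣m⇒∣m*n n ∣-refl)) 2∣w

positive-even⇒2≤ : ∀ {n} → 0 < n → 2 ∣ n → 2 ≤ n
positive-even⇒2≤ 0<n 2∣n = ∣⇒≤ {{>-nonZero 0<n}} 2∣n

-- Induction on A + B + C, which drops when the largest entry jumps. A jump needs the two other
-- entries to be at least 2. Conjugation preserves evenness, so `A` and `C` stay even and positive
-- and never fall to 1; the descent can therefore end only at B = 1.
halfAngle : ∀ A B C → 0 < A → 2 ∣ A → 0 < B → 0 < C → 2 ∣ C → CoshTriple A B C → HalfAngle A B C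
halfAngle A B C = go A B C (<-wellFounded (A + B + C))
  where
  Goal : ℕ → ℕ → ℕ → Set
  Goal A B C = 0 < A → 2 ∣ A → 0 < B → 0 < C → 2 ∣ C → CoshTriple A B C → HalfAngle A B C
  Smaller : ℕ → ℕ → ℕ → Set
  Smaller A B C = ∀ A′ B′ C′ → A′ + B′ + C′ < A + B + C → Goal A′ B′ C′
  C-largest : ∀ A B C → Smaller A B C → 2 ≤ B → A ≤ C → B ≤ C → Goal A B C
  C-largest A B C IH 2≤B A≤C B≤C 0<A 2∣A 0<B 0<C 2∣C t
    with vieta-jump A B C (positive-even⇒2≤ 0<A 2∣A) 2≤B A≤C B≤C t
  ... | C′ , sum , 0<C′ , C′<C , t′ =
    halfAngle-jump₃ A B C C′ sum
      (IH A B C′ (+-monoʳ-< (A + B) C′<C) 0<A 2∣A 0<B 0<C′ (conjugate-even (A * B) 2∣C sum) t′)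
  B-largest : ∀ A B C → Smaller A B C → A ≤ B → C ≤ B → Goal A B C
  B-largest A B C IH A≤B C≤B 0<A 2∣A 0<B 0<C 2∣C t
    with vieta-jump A C B (positive-even⇒2≤ 0<A 2∣A) (positive-even⇒2≤ 0<C 2∣C) A≤B C≤B (swap₂₃ A B C t)
  ... | B′ , sum , 0<B′ , B′<B , t′ =
    halfAngle-jump₂ A B B′ C sum (swap₂₃ A C B′ t′)
      (IH A B′ C (+-monoˡ-< C (+-monoʳ-< A B′<B)) 0<A 2∣A 0<B′ 0<C 2∣C (swap₂₃ A C B′ t′))
  reverse : ∀ A B C → CoshTriple A B C → CoshTriple C B A
  reverse A B C t = swap₂₃ C A B (swap₁₂ A C B (swap₂₃ A B C t))
  sum-reverse : ∀ A B C → A + B + C ≡ C + B + A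
  sum-reverse = solve-∀
  go : ∀ A B C → Acc _<_ (A + B + C) → Goal A B C
  go A 1 C _ _ _ _ _ _ t = halfAngle-base A C t
  go A B@(suc (suc _)) C (acc rec) 0<A 2∣A 0<B 0<C 2∣C t with ≤-total A C | ≤-total B C | ≤-total A B
  ... | inj₁ A≤C | inj₁ B≤C | _ = C-largest A B C IH (s≤s (s≤s z≤n)) A≤C B≤C 0<A 2∣A 0<B 0<C 2∣C t
    where
    IH : Smaller A B C
    IH A′ B′ C′ lt = go A′ B′ C′ (rec lt)
  ... | inj₁ A≤C | inj₂ C≤B | _ = B-largest A B C IH (≤-trans A≤C C≤B) C≤B 0<A 2∣A 0<B 0<C 2∣C t
    where
    IH : Smaller A B C
    IH A′ B′ C′ lt = go A′ B′ C′ (rec lt)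
  ... | inj₂ C≤A | _ | inj₁ A≤B = B-largest A B C IH A≤B (≤-trans C≤A A≤B) 0<A 2∣A 0<B 0<C 2∣C t
    where
    IH : Smaller A B C
    IH A′ B′ C′ lt = go A′ B′ C′ (rec lt)
  -- The half-angle relations are symmetric in `A` and `C`, so a largest `A` is treated as a largest
  -- `C` of the reversed triple.
  ... | inj₂ C≤A | _ | inj₂ B≤A = halfAngle-sym C B A
    (C-largest C B A IH (s≤s (s≤s z≤n)) C≤A B≤A 0<C 2∣C 0<B 0<A 2∣A (reverse A B C t))
    where
    IH : Smaller C B A
    IH A′ B′ C′ lt = go A′ B′ C′ (rec (subst (A′ + B′ + C′ <_) (sum-reverse C B A) lt))

-- Powers and the two parities of the exponent.

^-odd : ∀ {b} → (∃ λ q → b ≡ 1 + q * 2) → ∀ m → ∃ λ j → b ^ m ≡ 1 + j * 2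
^-odd _ zero = 0 , refl
^-odd (q , p) (suc m) with ^-odd (q , p) m
... | j , r = q + j + 2 * (q * j) , trans (cong₂ _*_ p r) (eq q j)
  where
  eq : ∀ q j → (1 + q * 2) * (1 + j * 2) ≡ 1 + (q + j + 2 * (q * j)) * 2
  eq = solve-∀

^-double : ∀ a m → a ^ (m * 2) ≡ a ^ m * a ^ m
^-double a m = trans (cong (a ^_) (trans (*-comm m 2) (cong (m +_) (+-identityʳ m)))) (^-distribˡ-+-* a m m)

square≢2mod4 : ∀ x k → ¬ (x * x ≡ 2 + k * 4)
square≢2mod4 x k p with even⊎odd x
... | y , inj₁ refl with trans (sym (m*n%n≡0 (y * y) 4)) (trans (cong (_% 4) (trans (eq y) p)) ([m+kn]%n≡m%n 2 k 4))
  where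
  eq : ∀ y → y * y * 4 ≡ y * 2 * (y * 2)
  eq = solve-∀
... | ()
square≢2mod4 x k p | y , inj₂ refl
  with trans (sym ([m+kn]%n≡m%n 1 (y + y * y) 4)) (trans (cong (_% 4) (trans (eq y) p)) ([m+kn]%n≡m%n 2 k 4))
  where
  eq : ∀ y → 1 + (y + y * y) * 4 ≡ (1 + y * 2) * (1 + y * 2)
  eq = solve-∀
... | ()

-- Here bⁿ = b (bᵐ)², and the odd square (bᵐ)² is 1 modulo 8, so bⁿ keeps the residue 3 of `b`.
odd-exponent : ∀ a b m x → 0 < a → 2 ∣ a → b % 8 ≡ 3 →
               ¬ ((a ^ (1 + m * 2) ∸ 1) * (b ^ (1 + m * 2) ∸ 1) ≡ x * x)
odd-exponent a b m x 0<a 2∣a b≡3 eq with ^-odd (±3mod8⇒odd b (inj₁ b≡3)) m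
... | j , bᵐ≡1+2j with odd²≡1mod8 j
... | t , [1+2j]²≡1+8t with ∣m⇒∣m*n (a ^ (m * 2)) 2∣a
-- A zero quotient would make aⁿ vanish; a successor quotient exhibits `aⁿ ∸ 1` as 1 + 2 i.
... | divides zero aⁿ≡0 = <⇒≢ (m^n>0 a {{>-nonZero 0<a}} (1 + m * 2)) (sym aⁿ≡0)
... | divides (suc i) aⁿ≡2+2i = square≢2mod4 x (i + 2 * s + 4 * (s * i)) (begin
    x * x                                               ≡⟨ eq ⟨
    (a ^ (1 + m * 2) ∸ 1) * (b ^ (1 + m * 2) ∸ 1)       ≡⟨ cong₂ (λ y z → (y ∸ 1) * (z ∸ 1)) aⁿ≡2+2i bⁿ≡3+8s ⟩
    (1 + i * 2) * (2 + s * 8)                           ≡⟨ expand i s ⟩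
    2 + (i + 2 * s + 4 * (s * i)) * 4                   ∎)
  where
  open ≡-Reasoning
  q s : ℕ
  q = b / 8
  s = q + 3 * t + 8 * (q * t)
  expand : ∀ i s → (1 + i * 2) * (2 + s * 8) ≡ 2 + (i + 2 * s + 4 * (s * i)) * 4
  expand = solve-∀
  multiply : ∀ q t → (3 + q * 8) * (1 + t * 8) ≡ 3 + (q + 3 * t + 8 * (q * t)) * 8
  multiply = solve-∀
  bⁿ≡3+8s : b ^ (1 + m * 2) ≡ 3 + s * 8
  bⁿ≡3+8s = begin
    b * b ^ (m * 2)                      ≡⟨ cong (b *_) (^-double b m) ⟩
    b * (b ^ m * b ^ m)                  ≡⟨ cong (λ z → b * (z * z)) bᵐ≡1+2j ⟩
    b * ((1 + j * 2) * (1 + j * 2))      ≡⟨ cong₂ _*_ (trans (m≡m%n+[m/n]*n b 8) (cong (_+ q * 8) b≡3)) [1+2j]²≡1+8t ⟩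
    (3 + q * 8) * (1 + t * 8)            ≡⟨ multiply q t ⟩
    3 + s * 8                            ∎

-- Positivity makes both subtractions exact: A² = 1 + α, B² = 1 + β and α β = x². Then A² + B² + x²
-- = 1 + A² B², and the terms of (A B + x)² supply the rest. In hyperbolic terms `x` is the product
-- of the two sinh values, and A B + x is the addition formula.
coshTriple : ∀ A B x → 0 < A → 0 < B → (A * A ∸ 1) * (B * B ∸ 1) ≡ x * x → CoshTriple A B (A * B + x)
coshTriple A B x 0<A 0<B eq = begin
  A * A + B * B + (A * B + x) * (A * B + x)                               ≡⟨ split A B x ⟩
  A * A + B * B + x * x + R                                               ≡⟨ cong₂ (λ y z → y + z + x * x + R) A²≡1+α B²≡1+β ⟩
  (1 + α) + (1 + β) + x * x + R                                           ≡⟨ cong (λ z → (1 + α) + (1 + β) + z + R) eq ⟨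
  (1 + α) + (1 + β) + α * β + R                                           ≡⟨ cong (_+ R) (factor α β) ⟩
  1 + (1 + α) * (1 + β) + R                                               ≡⟨ cong₂ (λ y z → 1 + y * z + R) A²≡1+α B²≡1+β ⟨
  1 + A * A * (B * B) + R                                                 ≡⟨ collect A B x ⟩
  1 + 2 * (A * B) * (A * B + x)                                           ∎
  where
  open ≡-Reasoning
  α β R : ℕ
  α = A * A ∸ 1
  β = B * B ∸ 1
  R = A * B * (A * B) + 2 * (A * B) * x
  A²≡1+α : A * A ≡ 1 + α
  A²≡1+α = sym (m+[n∸m]≡n (*-mono-≤ 0<A 0<A))
  B²≡1+β : B * B ≡ 1 + β
  B²≡1+β = sym (m+[n∸m]≡n (*-mono-≤ 0<B 0<B))
  split : ∀ A B x → A * A + B * B + (A * B + x) * (A * B + x) ≡ A * A + B * B + x * x + (A * B * (A * B) + 2 * (A * B) * x)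
  split = solve-∀
  factor : ∀ α β → (1 + α) + (1 + β) + α * β ≡ 1 + (1 + α) * (1 + β)
  factor = solve-∀
  collect : ∀ A B x → 1 + A * A * (B * B) + (A * B * (A * B) + 2 * (A * B) * x) ≡ 1 + 2 * (A * B) * (A * B + x)
  collect = solve-∀

-- Oddness of `B` serves to make the third entry A B + x even, as `halfAngle` demands: B² - 1 is
-- even, hence so are x² and `x`. Divisibility of `B` by `b` then reduces (2 X)² = 2 + 2 B to 2
-- modulo `b`.
[A²-1][B²-1]-nonsquare : ∀ b A B x → ±3mod8 b → 0 < A → 2 ∣ A → (∃ λ j → B ≡ 1 + j * 2) → b ∣ B →
                         ¬ ((A * A ∸ 1) * (B * B ∸ 1) ≡ x * x)
[A²-1][B²-1]-nonsquare b A B x b≡±3 0<A 2∣A (j , B≡1+2j) (divides c B≡cb) eq =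
  contradict (halfAngle A B (A * B + x) 0<A 2∣A 0<B
    (≤-trans (*-mono-≤ 0<A 0<B) (m≤m+n (A * B) x))
    (∣m∣n⇒∣m+n (∣m⇒∣m*n B 2∣A) 2∣x) (coshTriple A B x 0<A 0<B eq))
  where
  0<B : 0 < B
  0<B = subst (0 <_) (sym B≡1+2j) z<s
  square : ∀ j → (1 + j * 2) * (1 + j * 2) ≡ 1 + 2 * (j + j * j) * 2
  square = solve-∀
  2∣B²∸1 : 2 ∣ B * B ∸ 1
  2∣B²∸1 = divides (2 * (j + j * j)) (trans (cong (λ z → z * z ∸ 1) B≡1+2j) (cong (_∸ 1) (square j)))
  2∣x : 2 ∣ x
  2∣x = reduce (euclidsLemma x x prime[2] (subst (2 ∣_) eq (∣n⇒∣m*n (A * A ∸ 1) 2∣B²∸1)))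
  contradict : ¬ HalfAngle A B (A * B + x)
  contradict (X , _ , 1+B≡2X² , _) = 2-nonresidue b b≡±3 (2 * X) (2 * c) (begin
    2 * X * (2 * X)           ≡⟨ double X ⟩
    2 * (2 * (X * X))         ≡⟨ cong (2 *_) 1+B≡2X² ⟨
    2 * (1 + B)               ≡⟨ cong (λ z → 2 * (1 + z)) B≡cb ⟩
    2 * (1 + c * b)           ≡⟨ distrib b c ⟩
    2 + 2 * c * b             ∎)
    where
    open ≡-Reasoning
    double : ∀ X → 2 * X * (2 * X) ≡ 2 * (2 * (X * X))
    double = solve-∀
    distrib : ∀ b c → 2 * (1 + c * b) ≡ 2 + 2 * c * b
    distrib = solve-∀

-- Half the exponent is written `suc m` to be positive, so that `a ^ suc m` is even and `b` divides
-- `b ^ suc m`.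
even-exponent : ∀ a b m x → 0 < a → 2 ∣ a → b % 8 ≡ 3 →
                ¬ ((a ^ (suc m * 2) ∸ 1) * (b ^ (suc m * 2) ∸ 1) ≡ x * x)
even-exponent a b m x 0<a 2∣a b≡3 eq =
  [A²-1][B²-1]-nonsquare b (a ^ suc m) (b ^ suc m) x (inj₁ b≡3)
    (m^n>0 a {{>-nonZero 0<a}} (suc m)) (∣m⇒∣m*n (a ^ m) 2∣a)
    (^-odd (±3mod8⇒odd b (inj₁ b≡3)) (suc m)) (∣m⇒∣m*n (b ^ m) ∣-refl)
    (trans (sym (cong₂ (λ y z → (y ∸ 1) * (z ∸ 1)) (^-double a (suc m)) (^-double b (suc m)))) eq)

theorem2 : (a b : ℕ) → 0 < a → 2 ∣ a → Prime b → b % 8 ≡ 3 →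
    ¬ (∃₂ λ n x → 0 < n × 0 < x × (a ^ n ∸ 1) * (b ^ n ∸ 1) ≡ x * x)
theorem2 a b 0<a 2∣a _ b≡3 (n , x , 0<n , _ , eq) with even⊎odd n
... | zero , inj₁ refl = n≮0 0<n
... | suc m , inj₁ refl = even-exponent a b m x 0<a 2∣a b≡3 eq
... | m , inj₂ refl = odd-exponent a b m x 0<a 2∣a b≡3 eq
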